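{- Let $P$ be a finite poset and $t\geq 2$ a fixed integer. Then either $\mathrm{sat}^{\star}([t]^n,P)=O(1)$ as $n\to\infty$, or $\mathrm{sat}^{\star}([t]^n,P)\geq\log_t(n)$ for all $n$.
   Context: For positive integers $n,t$, $[n]=\{1,\dots,n\}$ and the hypergrid $[t]^n$ is the set of functions $f:[n]\to[t]$, partially ordered by $f\leq g$ iff $f(i)\leq g(i)$ for all $i\in[n]$. An induced copy of a poset $P$ in a family $\mathcal{F}\subseteq[t]^n$ is an injective map $\phi:P\to\mathcal{F}$ such that $\phi(x)\leq\phi(y)$ iff $x\leq_P y$. A family $\mathcal{F}\subseteq[t]^n$ is induced $P$-free if it contains no induced copy of $P$; it is induced $P$-saturated if it is induced $P$-free and for every $f\in[t]^n\setminus\mathcal{F}$ the family $\mathcal{F}\cup\{f\}$ contains an induced copy of $P$. Whenever $P$ embeds as an induced subposet of $[t]^n$, $\mathrm{sat}^{\star}([t]^n,P)$ denotes the minimum size of an induced $P$-saturated family in $[t]^n$. -}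

module Defs where

open import Level using (0ℓ)
open import Axiom.ExcludedMiddle using (ExcludedMiddle)
open import Data.Empty using (⊥-elim)
open import Data.Fin as Fin using (Fin)
open import Data.List using (List; []; _∷_; length; allFin; cartesianProductWith)
open import Data.List.Membership.Propositional using (_∈_; _∉_)
open import Data.List.Membership.Propositional.Properties using (∈-allFin; ∈-cartesianProductWith⁺)
open import Data.List.Relation.Unary.All.Properties using (¬Any⇒All¬)
open import Data.List.Relation.Unary.Any using (here; there)
open import Data.List.Relation.Unary.Unique.Propositional using (Unique; []; _∷_)
open import Data.Nat using (ℕ; zero; suc; _≤_; _<_; _^_)
open import Data.Nat.Induction using (<-wellFounded)
open import Data.Nat.Properties using (≤-antisym; ≮⇒≥)
open import Data.Product using (Σ; ∃; _×_; _,_; proj₁; proj₂)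
open import Data.Sum using (_⊎_; inj₁; inj₂)
open import Data.Vec using (Vec; []; _∷_; lookup)
open import Function.Bundles using (Inverse)
open import Induction.WellFounded using (Acc; acc)
open import Relation.Binary.Bundles using (Poset)
open import Relation.Binary.Morphism.Structures using (IsOrderMonomorphism)
open import Relation.Binary.PropositionalEquality using (_≡_; refl; setoid)
open import Relation.Nullary using (¬_; yes; no)
open import Relation.Unary using (Pred; U)

record FinitePoset : Set₁ where
  field
    poset       : Poset 0ℓ 0ℓ 0ℓ
    size        : ℕ
    enumeration : Inverse (Poset.Eq.setoid poset) (setoid (Fin size))
  open Poset poset public using (Carrier) renaming (_≈_ to _≈ᴾ_; _≤_ to _≤ᴾ_)

-- A function f : [n] → [t] is represented by its vector of values, with
-- {1,…,t} relabelled as Fin t, so that equality of functions is _≡_.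
Grid : ℕ → ℕ → Set
Grid t n = Vec (Fin t) n

_≤ᴳ_ : ∀ {t n} → Grid t n → Grid t n → Set
f ≤ᴳ g = ∀ i → lookup f i Fin.≤ lookup g i

-- A subset of the hypergrid is a list without repetitions; its size is the
-- length of the list.
record Family (t n : ℕ) : Set where
  constructor mkFamily
  field
    members : List (Grid t n)
    unique  : Unique members

open Family public

∣_∣ : ∀ {t n} → Family t n → ℕ
∣ F ∣ = length (members F)

module _ (P : FinitePoset) where
  open FinitePoset P

  InducedCopy : ∀ {t n} → Pred (Grid t n) 0ℓ → Set
  InducedCopy {t} {n} S = Σ (Carrier → Grid t n) λ φ →
    IsOrderMonomorphism _≈ᴾ_ _≡_ _≤ᴾ_ _≤ᴳ_ φ × (∀ x → S (φ x))

  Embeds : ℕ → ℕ → Set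
  Embeds t n = InducedCopy {t} {n} U

  InducedFree : ∀ {t n} → Family t n → Set
  InducedFree F = ¬ InducedCopy (_∈ members F)

  InducedSaturated : ∀ {t n} → Family t n → Set
  InducedSaturated F = InducedFree F ×
    (∀ f → f ∉ members F → InducedCopy (_∈ (f ∷ members F)))

  -- "sat⋆([t]ⁿ,P) is defined and equal to s".
  IsSat⋆ : ℕ → ℕ → ℕ → Set
  IsSat⋆ t n s = Embeds t n
    × (∃ λ (F : Family t n) → InducedSaturated F × ∣ F ∣ ≡ s)
    × (∀ (F : Family t n) → InducedSaturated F → s ≤ ∣ F ∣)

  Sat⋆IsO1 : ℕ → Set
  Sat⋆IsO1 t = ∃ λ C → ∃ λ N → ∀ n → N ≤ n → ∀ s → IsSat⋆ t n s → s ≤ C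

  -- log_t(n) ≤ s is expressed by exponentiating both sides: n ≤ tˢ.
  Sat⋆≥log : ℕ → Set
  Sat⋆≥log t = ∀ n → 1 ≤ n → ∀ s → IsSat⋆ t n s → n ≤ t ^ s

-- IsSat⋆ is the graph of a function, defined whenever P is nonempty and embeds
-- in the hypergrid.  (The empty poset has a copy in every family, so it admits
-- no saturated family at all.)
module _ (P : FinitePoset) {t n : ℕ} where
  open FinitePoset P

  sat⋆-unique : ∀ {s s′} → IsSat⋆ P t n s → IsSat⋆ P t n s′ → s ≡ s′
  sat⋆-unique (_ , (F , satF , refl) , minF) (_ , (G , satG , refl) , minG) =
    ≤-antisym (minF G satG) (minG F satF)

  module _ (em : ExcludedMiddle 0ℓ) (x₀ : Carrier) where

    allGrid : ∀ m → List (Grid t m)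
    allGrid zero    = [] ∷ []
    allGrid (suc m) = cartesianProductWith _∷_ (allFin t) (allGrid m)

    ∈-allGrid : ∀ {m} (f : Grid t m) → f ∈ allGrid m
    ∈-allGrid []      = here refl
    ∈-allGrid (a ∷ f) = ∈-cartesianProductWith⁺ _∷_ (∈-allFin a) (∈-allGrid f)

    Settled : List (Grid t n) → Grid t n → Set
    Settled F f = f ∈ F ⊎ InducedCopy P (_∈ (f ∷ F))

    settled-∷ : ∀ {F g} f → Settled F f → Settled (g ∷ F) f
    settled-∷ f (inj₁ f∈F)             = inj₁ (there f∈F)
    settled-∷ f (inj₂ (φ , mono , φ∈)) = inj₂ (φ , mono , λ x → weaken (φ∈ x))
      where
      weaken : ∀ {h g} {F : List (Grid t n)} → h ∈ f ∷ F → h ∈ f ∷ g ∷ F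
      weaken (here eq)  = here eq
      weaken (there h∈) = there (there h∈)

    greedy : ∀ (gs : List (Grid t n)) → ∃ λ F → InducedFree P F × (∀ f → f ∈ gs → Settled (members F) f)
    greedy []       = mkFamily [] [] , (λ (φ , _ , φ∈) → absurd (φ∈ x₀)) , λ _ ()
      where
      absurd : ∀ {f : Grid t n} → ¬ f ∈ []
      absurd ()
    greedy (g ∷ gs) with greedy gs
    ... | F , free , settled with em {g ∈ members F} | em {InducedCopy P (_∈ (g ∷ members F))}
    ... | yes g∈F | _        = F , free , λ where
      f (here refl) → inj₁ g∈F
      f (there f∈)  → settled f f∈
    ... | no _    | yes copy = F , free , λ where
      f (here refl) → inj₂ copy
      f (there f∈)  → settled f f∈
    ... | no g∉F  | no ¬copy = mkFamily (g ∷ members F) (¬Any⇒All¬ _ g∉F ∷ unique F) , ¬copy , λ where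
      f (here refl) → inj₁ (here refl)
      f (there f∈)  → settled-∷ f (settled f f∈)

    saturated-exists : ∃ λ (F : Family t n) → InducedSaturated P F
    saturated-exists with greedy (allGrid n)
    ... | F , free , settled = F , free , λ f f∉F → resolve f f∉F (settled f (∈-allGrid f))
      where
      resolve : ∀ f → f ∉ members F → Settled (members F) f → InducedCopy P (_∈ (f ∷ members F))
      resolve f f∉F (inj₁ f∈F)  = ⊥-elim (f∉F f∈F)
      resolve f f∉F (inj₂ copy) = copy

    sat⋆-exists : Embeds P t n → ∃ λ s → IsSat⋆ P t n s
    sat⋆-exists emb = descend (proj₁ saturated-exists) (proj₂ saturated-exists) (<-wellFounded _)
      where
      descend : ∀ F → InducedSaturated P F → Acc _<_ ∣ F ∣ → ∃ λ s → IsSat⋆ P t n s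
      descend F satF (acc rec) with em {∃ λ G → InducedSaturated P G × ∣ G ∣ < ∣ F ∣}
      ... | yes (G , satG , G<F) = descend G satG (rec G<F)
      ... | no ¬smaller = ∣ F ∣ , emb , (F , satF , refl) , λ G satG →
        ≮⇒≥ (λ G<F → ¬smaller (G , satG , G<F))

{-# OPTIONS --safe #-}
-- If some n > t^s has a minimum saturated family F of size s, then by the
-- pigeonhole principle two coordinates i ≠ j agree on every member of F.
-- Adding a further copy of coordinate i to every member keeps F saturated: the
-- comparisons of a new vector g with the members only see the minimum and the
-- maximum of its three entries at the twin coordinates, and these can be stored
-- at i and j in a vector of the old grid.  Iterating bounds sat⋆ by s for all
-- larger n.
module Submission where

open import Defs
open import Level using (0ℓ)
open import Axiom.ExcludedMiddle using (ExcludedMiddle)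
import Algebra.Construct.NaturalChoice.Max as NaturalMax
import Algebra.Construct.NaturalChoice.Min as NaturalMin
open import Data.Fin as Fin using (Fin; zero; suc; funToFin; finToFun)
open import Data.Fin.Properties as Fin using (pigeonhole; finToFun-funToFin)
open import Data.List as List using (List; _∷_; map)
open import Data.List.Membership.Propositional using (_∈_; _∉_)
open import Data.List.Membership.Propositional.Properties using (∈-map⁺; ∈-map⁻)
open import Data.List.Properties using (length-map)
open import Data.List.Relation.Unary.Any using (here; there; index)
open import Data.List.Relation.Unary.Any.Properties using (lookup-index)
open import Data.List.Relation.Unary.Unique.Propositional.Properties using (map⁺)
open import Data.Nat using (ℕ; suc; _≤_; _≤?_; _<_; _^_; _≤′_; ≤′-refl; ≤′-step)
open import Data.Nat.Properties using (≤-refl; ≤-trans; ≤-reflexive; ≰⇒>; ≤⇒≤′)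
open import Data.Product using (∃; _×_; _,_; proj₁; proj₂)
open import Data.Sum using (_⊎_; inj₁; inj₂)
open import Data.Vec using (_∷_; lookup; _[_]≔_)
open import Data.Vec.Properties using (∷-injectiveʳ; lookup∘update; lookup∘update′)
open import Data.Vec.Relation.Binary.Pointwise.Extensional using (ext; Pointwise-≡⇒≡)
open import Function using (_∘_)
open import Function.Bundles using (_⇔_; mk⇔; Equivalence)
open import Relation.Binary.Bundles using (Poset)
open import Relation.Binary.Morphism.Structures using (IsOrderMonomorphism)
open import Relation.Binary.PropositionalEquality using (_≡_; _≢_; refl; sym; trans; cong; subst; subst₂)
open import Relation.Nullary using (yes; no)
open import Relation.Nullary.Decidable using (decidable-stable)
open import Relation.Unary using (Pred)

open Equivalence using (to; from)

private
  variable
    t m n : ℕ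

≤ᴳ-refl : {f : Grid t n} → f ≤ᴳ f
≤ᴳ-refl i = ≤-refl

≤ᴳ-antisym : {f g : Grid t n} → f ≤ᴳ g → g ≤ᴳ f → f ≡ g
≤ᴳ-antisym f≤g g≤f = Pointwise-≡⇒≡ (ext λ i → Fin.≤-antisym (f≤g i) (g≤f i))

≤ᴳ-reflexive : {f g : Grid t n} → f ≡ g → f ≤ᴳ g
≤ᴳ-reflexive {f = f} refl = ≤ᴳ-refl {f = f}

module _ (P : FinitePoset) where
  open FinitePoset P

  -- The relation R need not be functional: an order embedding is determined up
  -- to equality by the order alone.
  transferCopy : {S : Pred (Grid t m) 0ℓ} {T : Pred (Grid t n) 0ℓ}
    (R : Grid t m → Grid t n → Set) →
    (∀ {u} → S u → ∃ λ v → R u v × T v) →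
    (∀ {u v u′ v′} → R u v → R u′ v′ → u ≤ᴳ u′ ⇔ v ≤ᴳ v′) →
    InducedCopy P S → InducedCopy P T
  transferCopy {t = t} {n = n} R total order (φ , φ-mono , φ∈S) = ψ , ψ-mono , ψ∈T
    where
    open IsOrderMonomorphism φ-mono
    module P = Poset poset

    ψ : Carrier → Grid t n
    ψ x = proj₁ (total (φ∈S x))

    ψ∈T = λ x → proj₂ (proj₂ (total (φ∈S x)))

    φ⇔ψ : ∀ x y → φ x ≤ᴳ φ y ⇔ ψ x ≤ᴳ ψ y
    φ⇔ψ x y = order (proj₁ (proj₂ (total (φ∈S x)))) (proj₁ (proj₂ (total (φ∈S y))))

    ψ-monotone : ∀ {x y} → x ≤ᴾ y → ψ x ≤ᴳ ψ y
    ψ-monotone {x} {y} x≤y = to (φ⇔ψ x y) (mono x≤y)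

    ψ-cancel : ∀ {x y} → ψ x ≤ᴳ ψ y → x ≤ᴾ y
    ψ-cancel {x} {y} = cancel ∘ from (φ⇔ψ x y)

    ψ-mono : IsOrderMonomorphism _≈ᴾ_ _≡_ _≤ᴾ_ _≤ᴳ_ ψ
    ψ-mono = record
      { isOrderHomomorphism = record
        { cong = λ x≈y → ≤ᴳ-antisym (ψ-monotone (P.reflexive x≈y)) (ψ-monotone (P.reflexive (P.Eq.sym x≈y)))
        ; mono = ψ-monotone
        }
      ; injective = λ eq → P.antisym (ψ-cancel (≤ᴳ-reflexive eq)) (ψ-cancel (≤ᴳ-reflexive (sym eq)))
      ; cancel    = ψ-cancel
      }

-- Distinctness is part of the notion because the two positions later have to store two different
-- values, a minimum and a maximum.
Twins : List (Grid t n) → Fin n → Fin n → Set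
Twins F i j = i ≢ j × (∀ {f} → f ∈ F → lookup f i ≡ lookup f j)

-- Coordinate `k` reads off a column, a map from positions in the list to `Fin t`. Only
-- `t ^ length F` columns exist, so two of the `n` coordinates have the same one.
twins-exist : (F : List (Grid t n)) → t ^ List.length F < n → ∃ λ i → ∃ λ j → Twins F i j
twins-exist {t} {n} F t^s<n with pigeonhole t^s<n (λ k → funToFin (column k))
  where
  column : Fin n → Fin (List.length F) → Fin t
  column k l = lookup (List.lookup F l) k
... | i , j , i<j , eq = i , j , Fin.<⇒≢ i<j , λ f∈F →
  -- The equality `eq` is between codes of columns; decoding both at the position of `f` compares
  -- the two entries of `f`.
  subst (λ f → lookup f i ≡ lookup f j) (sym (lookup-index f∈F))
    (trans (sym (finToFun-funToFin _ (index f∈F)))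
      (trans (cong (λ c → finToFun c (index f∈F)) eq) (finToFun-funToFin _ (index f∈F))))

duplicate : Fin n → Grid t n → Grid t (suc n)
duplicate i f = lookup f i ∷ f

duplicate-⇔ : ∀ i {f g : Grid t n} → f ≤ᴳ g ⇔ duplicate i f ≤ᴳ duplicate i g
duplicate-⇔ i = mk⇔ (λ { f≤g zero → f≤g i ; f≤g (suc k) → f≤g k }) (λ ef≤eg k → ef≤eg (suc k))

-- Keeps a twin pair available after a duplication, so that duplication can be iterated.
twins-duplicate : {F : List (Grid t n)} {i j : Fin n} →
  Twins F i j → Twins (map (duplicate i) F) (suc i) (suc j)
twins-duplicate {i = i} {j} (i≢j , same) = i≢j ∘ Fin.suc-injective , λ f∈ → agree (∈-map⁻ (duplicate i) f∈)
  where
  agree : ∀ {f} → (∃ λ h → h ∈ _ × f ≡ duplicate i h) → lookup f (suc i) ≡ lookup f (suc j)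
  agree (h , h∈F , refl) = same h∈F

module _ {t n : ℕ} {i j : Fin n} (i≢j : i ≢ j) (a : Fin t) (h : Grid t n) where
  open NaturalMin (Fin.≤-totalOrder t) using (_⊓_; x⊓y≤x; x⊓y≤y; ⊓-glb)
  open NaturalMax (Fin.≤-totalOrder t) using (_⊔_; x≤x⊔y; x≤y⊔x; ⊔-lub)

  private
    b c lo hi : Fin t
    b = lookup h i
    c = lookup h j
    lo = a ⊓ (b ⊓ c)
    hi = a ⊔ (b ⊔ c)

    lo≤b : lo Fin.≤ b
    lo≤b = ≤-trans (x⊓y≤y a (b ⊓ c)) (x⊓y≤x b c)

    lo≤c : lo Fin.≤ c
    lo≤c = ≤-trans (x⊓y≤y a (b ⊓ c)) (x⊓y≤y b c)

    b≤hi : b Fin.≤ hi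
    b≤hi = ≤-trans (x≤x⊔y b c) (x≤y⊔x a (b ⊔ c))

    c≤hi : c Fin.≤ hi
    c≤hi = ≤-trans (x≤y⊔x b c) (x≤y⊔x a (b ⊔ c))

  -- `lo` constrains the members below and `hi` the members above. Since `i ≢ j`, the second update
  -- leaves `lo` in place.
  collapse : Grid t n
  collapse = h [ i ]≔ lo [ j ]≔ hi

  private
    at-i : lookup collapse i ≡ lo
    at-i = trans (lookup∘update′ i≢j (h [ i ]≔ lo) hi) (lookup∘update i h lo)

    at-j : lookup collapse j ≡ hi
    at-j = lookup∘update j (h [ i ]≔ lo) hi

    elsewhere : ∀ {k} → k ≢ i → k ≢ j → lookup collapse k ≡ lookup h k
    elsewhere k≢i k≢j = trans (lookup∘update′ k≢j (h [ i ]≔ lo) hi) (lookup∘update′ k≢i h lo)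

    byCoordinate : {Q : Fin n → Set} → Q i → Q j → (∀ {k} → k ≢ i → k ≢ j → Q k) → ∀ k → Q k
    byCoordinate qi qj q k with k Fin.≟ i | k Fin.≟ j
    ... | yes refl | _        = qi
    ... | no _     | yes refl = qj
    ... | no k≢i   | no k≢j   = q k≢i k≢j

  module _ {f : Grid t n} (fi≡fj : lookup f i ≡ lookup f j) where

    -- The duplicate of `f` has one value `x` at all three twin coordinates, and `x` is below `a`,
    -- `b` and `c` exactly when `x ≤ lo`.
    below-collapse : f ≤ᴳ collapse ⇔ duplicate i f ≤ᴳ (a ∷ h)
    below-collapse = mk⇔ extend restrict
      where
      extend : f ≤ᴳ collapse → duplicate i f ≤ᴳ (a ∷ h)
      extend f≤ = λ { zero → ≤-trans fi≤lo (x⊓y≤x a (b ⊓ c)) ; (suc k) → rest k }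
        where
        fi≤lo : lookup f i Fin.≤ lo
        fi≤lo = subst (lookup f i Fin.≤_) at-i (f≤ i)

        rest : f ≤ᴳ h
        rest = byCoordinate {Q = λ k → lookup f k Fin.≤ lookup h k}
          (≤-trans fi≤lo lo≤b)
          (subst (Fin._≤ c) fi≡fj (≤-trans fi≤lo lo≤c))
          (λ k≢i k≢j → subst (_ Fin.≤_) (elsewhere k≢i k≢j) (f≤ _))

      restrict : duplicate i f ≤ᴳ (a ∷ h) → f ≤ᴳ collapse
      restrict ef≤ = byCoordinate {Q = λ k → lookup f k Fin.≤ lookup collapse k}
        (subst (lookup f i Fin.≤_) (sym at-i)
          (⊓-glb {lookup f i} {a} {b ⊓ c} (ef≤ zero)
            (⊓-glb {lookup f i} {b} {c} (ef≤ (suc i)) (subst (Fin._≤ c) (sym fi≡fj) (ef≤ (suc j))))))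
        -- The entry `hi` adds no constraint from below: being under `c` already suffices.
        (subst (lookup f j Fin.≤_) (sym at-j) (≤-trans (ef≤ (suc j)) c≤hi))
        (λ k≢i k≢j → subst (_ Fin.≤_) (sym (elsewhere k≢i k≢j)) (ef≤ (suc _)))

    -- Dual: the common value bounds `a`, `b` and `c` exactly when it bounds `hi`, and then it also
    -- bounds `lo`.
    above-collapse : collapse ≤ᴳ f ⇔ (a ∷ h) ≤ᴳ duplicate i f
    above-collapse = mk⇔ extend restrict
      where
      extend : collapse ≤ᴳ f → (a ∷ h) ≤ᴳ duplicate i f
      extend ≤f = λ { zero → ≤-trans (x≤x⊔y a (b ⊔ c)) hi≤fi ; (suc k) → rest k }
        where
        hi≤fi : hi Fin.≤ lookup f i
        hi≤fi = subst₂ Fin._≤_ at-j (sym fi≡fj) (≤f j)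

        rest : h ≤ᴳ f
        rest = byCoordinate {Q = λ k → lookup h k Fin.≤ lookup f k}
          (≤-trans b≤hi hi≤fi)
          (subst (c Fin.≤_) fi≡fj (≤-trans c≤hi hi≤fi))
          (λ k≢i k≢j → subst (Fin._≤ _) (elsewhere k≢i k≢j) (≤f _))

      restrict : (a ∷ h) ≤ᴳ duplicate i f → collapse ≤ᴳ f
      restrict ≤ef = byCoordinate {Q = λ k → lookup collapse k Fin.≤ lookup f k}
        (subst (Fin._≤ lookup f i) (sym at-i) (≤-trans lo≤b (≤ef (suc i))))
        (subst (Fin._≤ lookup f j) (sym at-j)
          (⊔-lub {lookup f j} {a} {b ⊔ c} (subst (a Fin.≤_) fi≡fj (≤ef zero))
            (⊔-lub {lookup f j} {b} {c} (subst (b Fin.≤_) fi≡fj (≤ef (suc i))) (≤ef (suc j)))))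
        (λ k≢i k≢j → subst (Fin._≤ _) (sym (elsewhere k≢i k≢j)) (≤ef (suc _)))

duplicateFamily : Fin n → Family t n → Family t (suc n)
duplicateFamily i F = mkFamily (map (duplicate i) (members F)) (map⁺ ∷-injectiveʳ (unique F))

module _ (P : FinitePoset) where

  duplicate-saturated : (F : Family t n) {i j : Fin n} → Twins (members F) i j →
    InducedSaturated P F → InducedSaturated P (duplicateFamily i F)
  duplicate-saturated {t} {n} F {i} (i≢j , same) (free , saturated) = free′ , saturated′
    where
    free′ : InducedFree P (duplicateFamily i F)
    -- Duplication preserves and reflects the order, so a copy among the duplicates pulls back to
    -- `F`.
    free′ = free ∘ transferCopy P {S = _∈ map (duplicate i) (members F)} {T = _∈ members F} (λ v u → v ≡ duplicate i u)
      (λ v∈ → let u , u∈F , v≡eu = ∈-map⁻ (duplicate i) v∈ in u , v≡eu , u∈F)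
      (λ { refl refl → mk⇔ (from (duplicate-⇔ i)) (to (duplicate-⇔ i)) })

    saturated′ : ∀ g → g ∉ map (duplicate i) (members F) → InducedCopy P (_∈ (g ∷ map (duplicate i) (members F)))
    saturated′ g@(a ∷ h) g∉ = transferCopy P R total order (saturated g* g*∉F)
      where
      g* : Grid t n
      g* = collapse i≢j a h

      g*∉F : g* ∉ members F
      -- If `g*` were a member, both comparisons applied to `g*` itself would force `g` to be its
      -- duplicate.
      g*∉F g*∈F = g∉ (subst (_∈ map (duplicate i) (members F))
        (≤ᴳ-antisym (to (below-collapse i≢j a h (same g*∈F)) (≤ᴳ-refl {f = g*}))
                    (to (above-collapse i≢j a h (same g*∈F)) (≤ᴳ-refl {f = g*})))
        (∈-map⁺ (duplicate i) g*∈F))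

      -- The copy that saturation provides for `g*` is carried over by sending `g*` to `g` and each
      -- member to its duplicate.
      R : Grid t n → Grid t (suc n) → Set
      R u v = (u ≡ g* × v ≡ g) ⊎ (u ∈ members F × v ≡ duplicate i u)

      total : ∀ {u} → u ∈ g* ∷ members F → ∃ λ v → R u v × v ∈ g ∷ map (duplicate i) (members F)
      total (here u≡g*) = g , inj₁ (u≡g* , refl) , here refl
      total (there u∈F) = _ , inj₂ (u∈F , refl) , there (∈-map⁺ (duplicate i) u∈F)

      order : ∀ {u v u′ v′} → R u v → R u′ v′ → u ≤ᴳ u′ ⇔ v ≤ᴳ v′
      order (inj₁ (refl , refl)) (inj₁ (refl , refl)) = mk⇔ (λ _ → ≤ᴳ-refl {f = g}) (λ _ → ≤ᴳ-refl {f = g*})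
      order (inj₁ (refl , refl)) (inj₂ (u∈F , refl))  = above-collapse i≢j a h (same u∈F)
      order (inj₂ (u∈F , refl)) (inj₁ (refl , refl))  = below-collapse i≢j a h (same u∈F)
      order (inj₂ (_ , refl)) (inj₂ (_ , refl))       = duplicate-⇔ i

  -- One duplication per step of `m ≤′ n`; the twin pair is part of the conclusion because the next
  -- step consumes it.
  stretch-saturated : (F : Family t m) {i j : Fin m} → Twins (members F) i j → InducedSaturated P F →
    m ≤′ n → ∃ λ (G : Family t n) → (∃ λ k → ∃ λ l → Twins (members G) k l) × InducedSaturated P G × ∣ G ∣ ≡ ∣ F ∣
  stretch-saturated F twins sat ≤′-refl = F , (_ , _ , twins) , sat , refl
  stretch-saturated F twins sat (≤′-step m≤n) with stretch-saturated F twins sat m≤n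
  ... | G , (k , l , twinsG) , satG , size =
    duplicateFamily k G , (suc k , suc l , twins-duplicate twinsG) , duplicate-saturated G twinsG satG ,
    trans (length-map (duplicate k) (members G)) size

  sat⋆-bounded : ∀ {s} → IsSat⋆ P t m s → t ^ s < m → Sat⋆IsO1 P t
  -- The bound is `s` itself, written `∣ F ∣`, and it is valid from dimension `m` on.
  sat⋆-bounded {t} {m} (_ , (F , satF , refl) , _) t^s<m = ∣ F ∣ , m , bound
    where
    bound : ∀ n → m ≤ n → ∀ s → IsSat⋆ P t n s → s ≤ ∣ F ∣
    bound n m≤n s (_ , _ , minimal) with twins-exist (members F) t^s<m
    ... | i , j , twins with stretch-saturated F twins satF (≤⇒≤′ m≤n)
    ... | G , _ , satG , size = ≤-trans (minimal G satG) (≤-reflexive size)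

mainTheorem7 : ExcludedMiddle 0ℓ → (P : FinitePoset) (t : ℕ) → 2 ≤ t → Sat⋆IsO1 P t ⊎ Sat⋆≥log P t
-- The dichotomy is whether the logarithmic bound fails in at least one dimension; a single failure
-- already gives boundedness.
mainTheorem7 em P t 2≤t with em {∃ λ n → ∃ λ s → IsSat⋆ P t n s × t ^ s < n}
... | yes (n , s , isSat , t^s<n) = inj₁ (sat⋆-bounded P isSat t^s<n)
... | no ¬small = inj₂ λ n 1≤n s isSat → decidable-stable (n ≤? t ^ s) λ n≰t^s →
  ¬small (n , s , isSat , ≰⇒> n≰t^s)
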